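{- Let $M$ be a structure in a countable vocabulary $L$ and let $\phi$ be a first order $L$-sentence in negation normal form. There is a mapping $\Phi$ such that for every strategy $\tau$ of Eloise in the evaluation game $G(M,\phi)$, $\Phi(\tau)$ is a strategy of Eloise in the model existence game $\mathrm{MEG}(\phi)$. If $\tau$ is a winning strategy, then so is $\Phi(\tau)$.
   Context: An assignment into a set $X$ is a map from a finite set of variables into $X$; $s(a/x)$ denotes the assignment agreeing with $s$ except that it sends $x$ to $a$. A formula is in negation normal form if negation occurs only in front of atomic formulas; the connectives are $\neg,\wedge,\vee,\forall,\exists$. Evaluation game $G(M,\phi)$: players Abelard and Eloise. Positions are pairs $(\psi,s)$ with $\psi$ a subformula of $\phi$ and $s$ an assignment into $M$; initial position $(\phi,\emptyset)$. At $(\psi,s)$: if $\psi$ is a literal, the game ends and Eloise wins iff $s$ satisfies $\psi$ in $M$; if $\psi=\psi_0\wedge\psi_1$, Abelard chooses the next position $(\psi_0,s)$ or $(\psi_1,s)$; if $\psi=\psi_0\vee\psi_1$, Eloise chooses it; if $\psi=\forall x\theta$, Abelard chooses $a\in M$ and the next position is $(\theta,s(a/x))$; if $\psi=\exists x\theta$, Eloise chooses $a\in M$ and the next position is $(\theta,s(a/x))$. A strategy is winning if its player wins every play following it. Model existence game $\mathrm{MEG}(\phi)$: let $C=\{c_0,c_1,\ldots\}$ be a countable set of new distinct constant symbols; a $C$-assignment is an assignment into $C$. Positions are finite sets $S$ of pairs $(\psi,s)$ with $\psi$ a subformula of $\phi$ and $s$ a $C$-assignment; the initial position is $\{(\phi,\emptyset)\}$.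 At each move, given the position $S$, Abelard selects a pair in $S$ and one of the following applies: if $(\psi_0\wedge\psi_1,s)\in S$, Abelard may decide that the next position is $S\cup\{(\psi_0,s)\}$ or $S\cup\{(\psi_1,s)\}$; if $(\psi_0\vee\psi_1,s)\in S$, Abelard may demand that Eloise choose whether the next position is $S\cup\{(\psi_0,s)\}$ or $S\cup\{(\psi_1,s)\}$; if $(\forall x\theta,s)\in S$, Abelard may choose $n\in\mathbb N$ and the next position is $S\cup\{(\theta,s(c_n/x))\}$; if $(\exists x\theta,s)\in S$, Abelard may demand that Eloise choose some $c_n$, and the next position is $S\cup\{(\theta,s(c_n/x))\}$. Abelard wins if at some point the position contains both $(\psi,s)$ and $(\neg\psi,s')$ with $\psi$ atomic and $s(x)=s'(x)$ for all variables $x$ of $\psi$. Otherwise (the game continuing for infinitely many moves) Eloise wins. -}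

module Defs where

open import Level using (Level; 0ℓ) renaming (suc to lsuc)
open import Data.Bool.Base using (if_then_else_)
open import Data.Empty.Polymorphic using (⊥)
open import Data.List.Base using (List; []; _∷_; [_])
open import Data.List.Membership.Propositional using (_∈_)
open import Data.Maybe.Base using (Maybe; just; nothing)
open import Data.Nat.Base using (ℕ; zero; suc)
open import Data.Nat.Properties using (_≟_)
open import Data.Product.Base using (Σ; ∃; ∃₂; _×_; _,_; proj₁; proj₂)
open import Data.Sum.Base using (_⊎_)
open import Data.Vec.Base using (Vec)
open import Data.Vec.Relation.Unary.Any using (Any)
open import Data.Vec.Relation.Binary.Pointwise.Inductive using (Pointwise)
open import Function.Bundles using (_↣_)
open import Relation.Binary.PropositionalEquality.Core using (_≡_; _≢_)
open import Relation.Nullary.Decidable.Core using (does)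
open import Relation.Nullary.Negation.Core using (¬_)

private variable
  ℓ : Level

-- Constant symbols are function symbols of arity 0.
record Vocabulary : Set₁ where
  field
    Rel   : Set
    Fun   : Set
    relAr : Rel → ℕ
    funAr : Fun → ℕ

Countable : Vocabulary → Set
Countable L = (Rel ↣ ℕ) × (Fun ↣ ℕ)
  where open Vocabulary L

Var : Set
Var = ℕ

module _ (L : Vocabulary) where
  open Vocabulary L

  data Term : Set where
    var  : Var → Term
    func : (f : Fun) → Vec Term (funAr f) → Term

  data Atomic : Set where
    _≐_ : Term → Term → Atomic
    rel : (R : Rel) → Vec Term (relAr R) → Atomic

  -- Formulas in negation normal form: the negation ∼_ applies to atomic
  -- formulas only.
  data Formula : Set where
    atom    : Atomic → Formula
    ∼_      : Atomic → Formula
    _∧_ _∨_ : Formula → Formula → Formula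
    ∀[_]_   : Var → Formula → Formula
    ∃[_]_   : Var → Formula → Formula

  record Structure ℓ : Set (lsuc ℓ) where
    field
      Carrier : Set ℓ
      -- Structures are non-empty.
      point   : Carrier
      ⟦rel⟧   : (R : Rel) → Vec Carrier (relAr R) → Set ℓ
      ⟦fun⟧   : (f : Fun) → Vec Carrier (funAr f) → Carrier

module _ {L : Vocabulary} where

  data _∈ᵗ_ (x : Var) : Term L → Set where
    var  : x ∈ᵗ var x
    func : ∀ {f ts} → Any (x ∈ᵗ_) ts → x ∈ᵗ func f ts

  _∈ᵃ_ : Var → Atomic L → Set
  x ∈ᵃ (t ≐ u)    = x ∈ᵗ t ⊎ x ∈ᵗ u
  x ∈ᵃ (rel R ts) = Any (x ∈ᵗ_) ts

  _FreeIn_ : Var → Formula L → Set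
  x FreeIn atom α     = x ∈ᵃ α
  x FreeIn (∼ α)      = x ∈ᵃ α
  x FreeIn (ψ₀ ∧ ψ₁)  = x FreeIn ψ₀ ⊎ x FreeIn ψ₁
  x FreeIn (ψ₀ ∨ ψ₁)  = x FreeIn ψ₀ ⊎ x FreeIn ψ₁
  x FreeIn (∀[ y ] θ) = x ≢ y × x FreeIn θ
  x FreeIn (∃[ y ] θ) = x ≢ y × x FreeIn θ

  Sentence : Formula L → Set
  Sentence φ = ∀ x → ¬ (x FreeIn φ)

-- A map from a finite set of variables, given by a finite list of bindings;
-- the leftmost binding of a variable is the one that counts.
Assignment : Set ℓ → Set ℓ
Assignment X = List (Var × X)

∅ : {X : Set ℓ} → Assignment X
∅ = []

lookup : {X : Set ℓ} → Assignment X → Var → Maybe X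
lookup []            y = nothing
lookup ((x , a) ∷ s) y = if does (x ≟ y) then just a else lookup s y

_[_/_] : {X : Set ℓ} → Assignment X → X → Var → Assignment X
s [ a / x ] = (x , a) ∷ s

module _ {L : Vocabulary} (M : Structure L ℓ) where
  open Structure M

  data Value (s : Assignment Carrier) : Term L → Carrier → Set ℓ where
    var  : ∀ {x a} → lookup s x ≡ just a → Value s (var x) a
    func : ∀ {f ts as} → Pointwise (Value s) ts as →
           Value s (func f ts) (⟦fun⟧ f as)

  Satisfies : Assignment Carrier → Atomic L → Set ℓ
  Satisfies s (t ≐ u)    = ∃ λ a → Value s t a × Value s u a
  Satisfies s (rel R ts) = ∃ λ as → Pointwise (Value s) ts as × ⟦rel⟧ R as

data Player : Set where
  abelard eloise : Player

record Arena ℓ : Set (lsuc ℓ) where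
  field
    Position : Set ℓ
    initial  : Position
    -- `nothing' at positions where the game has ended.
    turn     : Position → Maybe Player
    Move     : Position → Set ℓ
    next     : (p : Position) → Move p → Position

module _ (A : Arena ℓ) where
  open Arena A

  data History : Position → Set ℓ where
    start : History initial
    _▷_   : ∀ {p} → History p → (m : Move p) → History (next p m)

  record InfinitePlay : Set ℓ where
    field
      stage  : ℕ → Σ Position History
      stage₀ : stage zero ≡ (initial , start)
      step   : ∀ n → Σ (Move (proj₁ (stage n))) λ m →
               stage (suc n) ≡ (_ , proj₂ (stage n) ▷ m)

  data Play : Set ℓ where
    finite   : ∀ {p} → History p → ¬ Move p → Play
    infinite : InfinitePlay → Play

  -- Eloise's strategies may depend on the whole history of the play.
  Strategy : Set ℓ
  Strategy = ∀ {p} → History p → turn p ≡ just eloise → Move p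

module _ {A : Arena ℓ} where
  open Arena A

  data PassesThrough (q : Position) : ∀ {p} → History A p → Set ℓ where
    now     : {h : History A q} → PassesThrough q h
    earlier : ∀ {p} {h : History A p} {m : Move p} →
              PassesThrough q h → PassesThrough q (h ▷ m)

  Visits : Play A → Position → Set ℓ
  Visits (finite h _) q = PassesThrough q h
  Visits (infinite π) q = ∃ λ n → proj₁ (InfinitePlay.stage π n) ≡ q

  data HistoryFollows (σ : Strategy A) : ∀ {p} → History A p → Set ℓ where
    start : HistoryFollows σ start
    _▷_   : ∀ {p} {h : History A p} {m : Move p} → HistoryFollows σ h →
            ((e : turn p ≡ just eloise) → m ≡ σ h e) →
            HistoryFollows σ (h ▷ m)

  Follows : Strategy A → Play A → Set ℓ
  Follows σ (finite h _) = HistoryFollows σ h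
  Follows σ (infinite π) =
    ∀ n → HistoryFollows σ (proj₂ (InfinitePlay.stage π n))

record Game ℓ : Set (lsuc ℓ) where
  field
    arena      : Arena ℓ
    EloiseWins : Play arena → Set ℓ

EloiseStrategy : Game ℓ → Set ℓ
EloiseStrategy G = Strategy (Game.arena G)

Winning : (G : Game ℓ) → EloiseStrategy G → Set ℓ
Winning G σ = ∀ π → Follows σ π → Game.EloiseWins G π

-- In both games below the positions range over all formulas; every history
-- starts at φ, so only subformulas of φ ever occur in one.

module Evaluation {L : Vocabulary} (M : Structure L ℓ) where
  open Structure M

  Position : Set ℓ
  Position = Formula L × Assignment Carrier

  turn : Position → Maybe Player
  turn (atom _    , _) = nothing
  turn (∼ _       , _) = nothing
  turn (_ ∧ _     , _) = just abelard
  turn (_ ∨ _     , _) = just eloise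
  turn (∀[ _ ] _  , _) = just abelard
  turn (∃[ _ ] _  , _) = just eloise

  data Move : Position → Set ℓ where
    ∧-left ∧-right : ∀ {ψ₀ ψ₁ s} → Move (ψ₀ ∧ ψ₁ , s)
    ∨-left ∨-right : ∀ {ψ₀ ψ₁ s} → Move (ψ₀ ∨ ψ₁ , s)
    ∀-choose       : ∀ {x θ s} → Carrier → Move (∀[ x ] θ , s)
    ∃-choose       : ∀ {x θ s} → Carrier → Move (∃[ x ] θ , s)

  next : (p : Position) → Move p → Position
  next (ψ₀ ∧ ψ₁  , s) ∧-left       = ψ₀ , s
  next (ψ₀ ∧ ψ₁  , s) ∧-right      = ψ₁ , s
  next (ψ₀ ∨ ψ₁  , s) ∨-left       = ψ₀ , s
  next (ψ₀ ∨ ψ₁  , s) ∨-right      = ψ₁ , s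
  next (∀[ x ] θ , s) (∀-choose a) = θ , s [ a / x ]
  next (∃[ x ] θ , s) (∃-choose a) = θ , s [ a / x ]

  arena : Formula L → Arena ℓ
  arena φ = record
    { Position = Position ; initial = φ , ∅
    ; turn = turn ; Move = Move ; next = next }

  -- Only literals lack moves, the carrier being non-empty, so the last clause
  -- never applies to the end of a play.
  WonAt : Position → Set ℓ
  WonAt (atom α , s) = Satisfies M s α
  WonAt (∼ α    , s) = ¬ Satisfies M s α
  WonAt _            = ⊥

  -- There are no infinite plays: each move passes to a proper subformula.
  EloiseWins : ∀ φ → Play (arena φ) → Set ℓ
  EloiseWins φ (finite {p} _ _) = WonAt p
  EloiseWins φ (infinite _)     = ⊥

evaluationGame : {L : Vocabulary} → Structure L ℓ → Formula L → Game ℓ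
evaluationGame M φ = record
  { arena = Evaluation.arena M φ ; EloiseWins = Evaluation.EloiseWins M φ }

data C : Set where
  c : ℕ → C

module ModelExistence (L : Vocabulary) where

  Pair : Set
  Pair = Formula L × Assignment C

  -- Finite sets as lists, of which only membership matters to the rules.
  PairSet : Set
  PairSet = List Pair

  -- A demand by Abelard that Eloise has yet to answer is a position of its
  -- own, with the set of pairs unchanged.
  data Position : Set where
    free     : PairSet → Position
    demand-∨ : PairSet → (ψ₀ ψ₁ : Formula L) → Assignment C → Position
    demand-∃ : PairSet → (x : Var) (θ : Formula L) → Assignment C → Position

  pairs : Position → PairSet
  pairs (free S)           = S
  pairs (demand-∨ S _ _ _) = S
  pairs (demand-∃ S _ _ _) = S

  turn : Position → Maybe Player
  turn (free _)           = just abelard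
  turn (demand-∨ _ _ _ _) = just eloise
  turn (demand-∃ _ _ _ _) = just eloise

  data Move : Position → Set where
    ∧-left ∧-right : ∀ {S ψ₀ ψ₁ s} → (ψ₀ ∧ ψ₁ , s) ∈ S → Move (free S)
    ∨-ask          : ∀ {S ψ₀ ψ₁ s} → (ψ₀ ∨ ψ₁ , s) ∈ S → Move (free S)
    ∀-choose       : ∀ {S x θ s} → (∀[ x ] θ , s) ∈ S → ℕ → Move (free S)
    ∃-ask          : ∀ {S x θ s} → (∃[ x ] θ , s) ∈ S → Move (free S)
    ∨-left ∨-right : ∀ {S ψ₀ ψ₁ s} → Move (demand-∨ S ψ₀ ψ₁ s)
    ∃-choose       : ∀ {S x θ s} → ℕ → Move (demand-∃ S x θ s)

  next : (p : Position) → Move p → Position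
  next (free S) (∧-left  {ψ₀ = ψ₀} {s = s} _)         = free ((ψ₀ , s) ∷ S)
  next (free S) (∧-right {ψ₁ = ψ₁} {s = s} _)         = free ((ψ₁ , s) ∷ S)
  next (free S) (∨-ask {ψ₀ = ψ₀} {ψ₁} {s} _)          = demand-∨ S ψ₀ ψ₁ s
  next (free S) (∀-choose {x = x} {θ} {s} _ n)        = free ((θ , s [ c n / x ]) ∷ S)
  next (free S) (∃-ask {x = x} {θ} {s} _)             = demand-∃ S x θ s
  next (demand-∨ S ψ₀ ψ₁ s) ∨-left                    = free ((ψ₀ , s) ∷ S)
  next (demand-∨ S ψ₀ ψ₁ s) ∨-right                   = free ((ψ₁ , s) ∷ S)
  next (demand-∃ S x θ s)   (∃-choose n)              = free ((θ , s [ c n / x ]) ∷ S)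

  arena : Formula L → Arena 0ℓ
  arena φ = record
    { Position = Position ; initial = free [ φ , ∅ ]
    ; turn = turn ; Move = Move ; next = next }

  Clash : PairSet → Set
  Clash S = ∃ λ α → ∃₂ λ s s′ → (atom α , s) ∈ S × (∼ α , s′) ∈ S ×
            (∀ x → x ∈ᵃ α → lookup s x ≡ lookup s′ x)

  AbelardWins : ∀ φ → Play (arena φ) → Set
  AbelardWins φ π = ∃ λ p → Visits π p × Clash (pairs p)

  EloiseWins : ∀ φ → Play (arena φ) → Set
  EloiseWins φ π = ¬ AbelardWins φ π

modelExistenceGame : {L : Vocabulary} → Formula L → Game 0ℓ
modelExistenceGame {L = L} φ = record
  { arena = ModelExistence.arena L φ ; EloiseWins = ModelExistence.EloiseWins L φ }

{-# OPTIONS --safe #-}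
-- While playing MEG(φ), Eloise keeps an interpretation of the constants used
-- so far in M, and for every pair (ψ , s) of the current position a play of
-- G(M,φ) which follows τ and ends at ψ with the interpretation of s. Her
-- answers are copied from τ; a witness a ∈ M of an existential formula is named
-- by a fresh constant interpreted as a, and constants introduced by Abelard are
-- interpreted by the default point of M. If τ is winning, all literals in the
-- position are then true in M, so that no two of them clash.
module Submission where

open import Data.Bool.Base using (if_then_else_; true; false)
open import Data.List.Base using ([]; _∷_)
open import Data.List.Membership.Propositional using (_∈_)
open import Data.List.Relation.Unary.Any using (here; there)
open import Data.Maybe.Base using (just)
import Data.Maybe.Base as Maybe
open import Data.Nat.Base using (ℕ; zero; suc; _<_; _≤_; _⊔_)
open import Data.Nat.Properties using (_≟_; ≤-refl; ≤-trans; <⇒≢; n≤1+n; m≤m⊔n; m≤n⊔m)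
open import Data.Product.Base using (Σ; _×_; _,_; proj₁; proj₂)
open import Data.Sum.Base using (inj₁; inj₂)
open import Data.Vec.Base using (Vec)
open import Data.Vec.Relation.Binary.Pointwise.Inductive as Vec using ([]; _∷_)
open import Data.Vec.Relation.Unary.Any using (Any; here; there)
open import Function.Base using (_∘_)
open import Level using (Level)
open import Relation.Binary.PropositionalEquality using (_≡_; refl; sym; trans; cong)
open import Relation.Nullary.Decidable.Core using (does)
open import Relation.Nullary.Decidable using (dec-true; dec-false)
open import Relation.Nullary.Negation.Core using (¬_)

open import Defs

private variable
  ℓ : Level

module _ {L : Vocabulary} (M : Structure L ℓ) where
  open Structure M

  private variable
    s s′ : Assignment Carrier

  mutual
    Value-cong : ∀ {t a} → (∀ x → x ∈ᵗ t → lookup s x ≡ lookup s′ x) →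
                 Value M s t a → Value M s′ t a
    Value-cong s≗s′ (var eq)  = var (trans (sym (s≗s′ _ var)) eq)
    Value-cong s≗s′ (func vs) = func (Values-cong (λ x → s≗s′ x ∘ func) vs)

    Values-cong : ∀ {n} {ts : Vec (Term L) n} {as : Vec Carrier n} →
                  (∀ x → Any (x ∈ᵗ_) ts → lookup s x ≡ lookup s′ x) →
                  Vec.Pointwise (Value M s) ts as → Vec.Pointwise (Value M s′) ts as
    Values-cong s≗s′ []       = []
    Values-cong s≗s′ (v ∷ vs) =
      Value-cong (λ x → s≗s′ x ∘ here) v ∷ Values-cong (λ x → s≗s′ x ∘ there) vs

  -- A clash makes its two assignments agree only on the variables of the atomic formula; truth can
  -- still be moved from one to the other.
  Satisfies-cong : ∀ α → (∀ x → x ∈ᵃ α → lookup s x ≡ lookup s′ x) →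
                   Satisfies M s α → Satisfies M s′ α
  Satisfies-cong (t ≐ u) s≗s′ (a , v , w) =
    a , Value-cong (λ x → s≗s′ x ∘ inj₁) v , Value-cong (λ x → s≗s′ x ∘ inj₂) w
  Satisfies-cong (rel R ts) s≗s′ (as , vs , r) = as , Values-cong s≗s′ vs , r

index : C → ℕ
index (c n) = n

module _ {X : Set ℓ} where

  private variable
    I J : ℕ → X
    m n : ℕ
    s   : Assignment C
    t   : Assignment X

  update : (ℕ → X) → ℕ → X → ℕ → X
  update I n a k = if does (k ≟ n) then a else I k

  update-at : ∀ (I : ℕ → X) n a → update I n a n ≡ a
  update-at I n a rewrite dec-true (n ≟ n) refl = refl

  update-below : ∀ (I : ℕ → X) n a {k} → k < n → update I n a k ≡ I k
  update-below I n a {k} k<n rewrite dec-false (k ≟ n) (<⇒≢ k<n) = refl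

  -- Bindings are matched one by one, in the same order, so shadowing agrees on both sides. Every
  -- constant in use has index below `n`, which leaves `c n` fresh.
  data Interprets (I : ℕ → X) (n : ℕ) : Assignment C → Assignment X → Set ℓ where
    []  : Interprets I n [] []
    _∷_ : ∀ {x k a s t} → k < n × I k ≡ a → Interprets I n s t →
          Interprets I n ((x , c k) ∷ s) ((x , a) ∷ t)

  -- Only the values of `I` below `m` matter, so fresh constants may be reinterpreted and the bound
  -- may be raised.
  Interprets-mono : m ≤ n → (∀ {k} → k < m → J k ≡ I k) →
                    Interprets I m s t → Interprets J n s t
  Interprets-mono m≤n J≗I [] = []
  Interprets-mono m≤n J≗I ((k<m , Ik≡a) ∷ st) =
    (≤-trans k<m m≤n , trans (J≗I k<m) Ik≡a) ∷ Interprets-mono m≤n J≗I st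

  Interprets-lookup : Interprets I n s t → ∀ x → lookup t x ≡ Maybe.map (I ∘ index) (lookup s x)
  Interprets-lookup [] x = refl
  Interprets-lookup {s = (y , _) ∷ _} ((_ , Ik≡a) ∷ st) x with does (y ≟ x)
  ... | true  = cong just (sym Ik≡a)
  ... | false = Interprets-lookup st x

module Transfer {L : Vocabulary} (M : Structure L ℓ) (φ : Formula L)
                (τ : EloiseStrategy (evaluationGame M φ)) where
  open Structure M
  module E = Evaluation M
  module G = ModelExistence L

  record Track (q : G.Pair) : Set ℓ where
    constructor _,_
    field
      assignment : Assignment Carrier
      history    : History (E.arena φ) (proj₁ q , assignment)
  open Track

  record Config (S : G.PairSet) : Set ℓ where
    constructor config
    field
      interp : ℕ → Carrier
      fresh  : ℕ
      track  : ∀ {q} → q ∈ S → Track q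
  open Config

  -- A pending demand carries no membership proof, so the history of the demanded formula is kept
  -- beside the configuration.
  State : G.Position → Set ℓ
  State (G.free S)             = Config S
  State (G.demand-∨ S ψ₀ ψ₁ s) = Config S × Track (ψ₀ ∨ ψ₁ , s)
  State (G.demand-∃ S x θ s)   = Config S × Track (∃[ x ] θ , s)

  extend : ∀ {q S} → Track q → (∀ {r} → r ∈ S → Track r) → ∀ {r} → r ∈ q ∷ S → Track r
  extend h hs (here refl) = h
  extend h hs (there i)   = hs i

  witness : ∀ {x θ t} → E.Move (∃[ x ] θ , t) → Carrier
  witness (E.∃-choose a) = a

  -- Off Eloise's strategy this may reinterpret a constant already in use; only
  -- histories following her strategy have sound states.
  advance : ∀ p (m : G.Move p) → State p → State (G.next p m)
  advance (G.free S) (G.∧-left i) (config I n hs) =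
    let t , h = hs i in config I n (extend (t , h ▷ E.∧-left) hs)
  advance (G.free S) (G.∧-right i) (config I n hs) =
    let t , h = hs i in config I n (extend (t , h ▷ E.∧-right) hs)
  advance (G.free S) (G.∨-ask i) st = st , track st i
  advance (G.free S) (G.∀-choose i k) (config I n hs) =
    -- The constant may be old or new; `I` has a value for it in either case, and the maximum puts
    -- the bound above both kinds.
    let t , h = hs i in config I (n ⊔ suc k) (extend (_ , h ▷ E.∀-choose (I k)) hs)
  advance (G.free S) (G.∃-ask i) st = st , track st i
  advance (G.demand-∨ S ψ₀ ψ₁ s) G.∨-left (config I n hs , t , h) =
    config I n (extend (t , h ▷ E.∨-left) hs)
  advance (G.demand-∨ S ψ₀ ψ₁ s) G.∨-right (config I n hs , t , h) =
    config I n (extend (t , h ▷ E.∨-right) hs)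
  advance (G.demand-∃ S x θ s) (G.∃-choose k) (config I n hs , t , h) =
    let a = witness (τ h refl) in
    config (update I k a) (suc k) (extend (_ , h ▷ E.∃-choose a) hs)

  state : ∀ {p} → History (G.arena φ) p → State p
  state start   = config (λ _ → point) zero λ { (here refl) → ∅ , start }
  state (h ▷ m) = advance _ m (state h)

  copy-∨ : ∀ {S ψ₀ ψ₁ s t} → E.Move (ψ₀ ∨ ψ₁ , t) → G.Move (G.demand-∨ S ψ₀ ψ₁ s)
  copy-∨ E.∨-left  = G.∨-left
  copy-∨ E.∨-right = G.∨-right

  answer : ∀ p → State p → G.turn p ≡ just eloise → G.Move p
  answer (G.demand-∨ S ψ₀ ψ₁ s) (_ , _ , h) refl = copy-∨ (τ h refl)
  -- Only the name is chosen here; `advance` then interprets it by the witness taken from `τ`.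
  answer (G.demand-∃ S x θ s) (cfg , _) refl     = G.∃-choose (fresh cfg)

  strategy : EloiseStrategy (modelExistenceGame φ)
  strategy {p} h = answer p (state h)

  -- Kept apart from `Config`, since `strategy` has to answer after every history, including those
  -- where these conditions fail.
  record Sound (I : ℕ → Carrier) (n : ℕ) {q : G.Pair} (h : Track q) : Set ℓ where
    constructor _,_
    field
      follows    : HistoryFollows τ (history h)
      interprets : Interprets I n (proj₂ q) (assignment h)

  SoundConfig : ∀ {S} → Config S → Set ℓ
  SoundConfig {S} cfg = ∀ {q} (i : q ∈ S) → Sound (interp cfg) (fresh cfg) (track cfg i)

  SoundState : ∀ p → State p → Set ℓ
  SoundState (G.free S) cfg = SoundConfig cfg
  SoundState (G.demand-∨ S ψ₀ ψ₁ s) (cfg , h) =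
    SoundConfig cfg × Sound (interp cfg) (fresh cfg) h
  SoundState (G.demand-∃ S x θ s) (cfg , h) =
    SoundConfig cfg × Sound (interp cfg) (fresh cfg) h

  extend-sound : ∀ {I n q S} {h : Track q} {hs : ∀ {r} → r ∈ S → Track r} →
                 Sound I n h → (∀ {r} (i : r ∈ S) → Sound I n (hs i)) →
                 SoundConfig (config I n (extend h hs))
  extend-sound h-ok hs-ok (here refl) = h-ok
  extend-sound h-ok hs-ok (there i)   = hs-ok i

  Sound-mono : ∀ {I J m n q} {h : Track q} → m ≤ n → (∀ {k} → k < m → J k ≡ I k) →
               Sound I m h → Sound J n h
  Sound-mono m≤n J≗I (f , st) = f , Interprets-mono m≤n J≗I st

  copy-∨-left : ∀ {S ψ₀ ψ₁ s t} (m : E.Move (ψ₀ ∨ ψ₁ , t)) →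
                G.∨-left {S} {s = s} ≡ copy-∨ m → E.∨-left ≡ m
  copy-∨-left E.∨-left _ = refl

  copy-∨-right : ∀ {S ψ₀ ψ₁ s t} (m : E.Move (ψ₀ ∨ ψ₁ , t)) →
                 G.∨-right {S} {s = s} ≡ copy-∨ m → E.∨-right ≡ m
  copy-∨-right E.∨-right _ = refl

  ∃-choose-witness : ∀ {x θ t} (m : E.Move (∃[ x ] θ , t)) → E.∃-choose (witness m) ≡ m
  ∃-choose-witness (E.∃-choose _) = refl

  -- Conjunctions and universal formulas belong to Abelard in the evaluation game too, so extending
  -- a history by his choice still follows `τ`. At disjunctions and existential formulas, the copied
  -- move is the one `τ` prescribes.
  advance-sound : ∀ p (m : G.Move p) (st : State p) → SoundState p st →
                  (∀ e → m ≡ answer p st e) → SoundState (G.next p m) (advance p m st)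
  advance-sound (G.free S) (G.∧-left i) st ok _ =
    let f , ρ = ok i in extend-sound (f ▷ (λ ()) , ρ) ok
  advance-sound (G.free S) (G.∧-right i) st ok _ =
    let f , ρ = ok i in extend-sound (f ▷ (λ ()) , ρ) ok
  advance-sound (G.free S) (G.∨-ask i) st ok _ = ok , ok i
  advance-sound (G.free S) (G.∀-choose i k) st ok _ =
    let n     = fresh st
        n≤    = m≤m⊔n n (suc k)
        f , ρ = ok i
    in extend-sound
         ( f ▷ (λ ())
         , (m≤n⊔m n (suc k) , refl) ∷ Interprets-mono n≤ (λ _ → refl) ρ )
         (λ j → Sound-mono n≤ (λ _ → refl) (ok j))
  advance-sound (G.free S) (G.∃-ask i) st ok _ = ok , ok i
  advance-sound (G.demand-∨ S ψ₀ ψ₁ s) G.∨-left (cfg , t , h) (ok , f , ρ) by-τ =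
    extend-sound (f ▷ (λ { refl → copy-∨-left (τ h refl) (by-τ refl) }) , ρ) ok
  advance-sound (G.demand-∨ S ψ₀ ψ₁ s) G.∨-right (cfg , t , h) (ok , f , ρ) by-τ =
    extend-sound (f ▷ (λ { refl → copy-∨-right (τ h refl) (by-τ refl) }) , ρ) ok
  advance-sound (G.demand-∃ S x θ s) (G.∃-choose k) (config I n hs , t , h) (ok , f , ρ) by-τ
    -- Following the strategy identifies `k` with the fresh `n`, so the update leaves all earlier
    -- interpretations intact.
    with refl ← by-τ refl =
    let a = witness (τ h refl) in
    extend-sound
      ( f ▷ (λ { refl → ∃-choose-witness (τ h refl) })
      , (≤-refl , update-at I n a) ∷ Interprets-mono (n≤1+n n) (update-below I n a) ρ )
      (λ i → Sound-mono (n≤1+n n) (update-below I n a) (ok i))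

  state-sound : ∀ {p} {h : History (G.arena φ) p} → HistoryFollows strategy h →
                SoundState p (state h)
  state-sound start = λ { (here refl) → start , [] }
  state-sound (_▷_ {p} {h} {m} f by-τ) =
    advance-sound p m (state h) (state-sound f) by-τ

  configOf : ∀ p → State p → Config (G.pairs p)
  configOf (G.free _)           st        = st
  configOf (G.demand-∨ _ _ _ _) (cfg , _) = cfg
  configOf (G.demand-∃ _ _ _ _) (cfg , _) = cfg

  configOf-sound : ∀ p (st : State p) → SoundState p st → SoundConfig (configOf p st)
  configOf-sound (G.free _)           _ ok       = ok
  configOf-sound (G.demand-∨ _ _ _ _) _ (ok , _) = ok
  configOf-sound (G.demand-∃ _ _ _ _) _ (ok , _) = ok

  module _ (τ-wins : Winning (evaluationGame M φ) τ) where

    -- A literal allows no move, so the histories tracked for the two clashing literals are complete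
    -- plays won by `τ`: one makes `α` true, the other makes it false.
    sound⇒¬clash : ∀ {S} (cfg : Config S) → SoundConfig cfg → ¬ G.Clash S
    sound⇒¬clash cfg ok (α , s , s′ , i , j , s≗s′) =
      let t  , h  = track cfg i
          t′ , h′ = track cfg j
          f  , ρ  = ok i
          f′ , ρ′ = ok j
          -- Both assignments are read through the same interpretation, so agreement on constants
          -- becomes agreement on elements.
          t≗t′ : ∀ x → x ∈ᵃ α → lookup t x ≡ lookup t′ x
          t≗t′ x x∈α = trans (Interprets-lookup ρ x)
            (trans (cong (Maybe.map (interp cfg ∘ index)) (s≗s′ x x∈α))
                   (sym (Interprets-lookup ρ′ x)))
      in τ-wins (finite h′ λ ()) f′ (Satisfies-cong M α t≗t′ (τ-wins (finite h λ ()) f))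

    follows⇒¬clash : ∀ {p} {h : History (G.arena φ) p} → HistoryFollows strategy h →
                     ¬ G.Clash (G.pairs p)
    follows⇒¬clash {p} {h} f =
      sound⇒¬clash (configOf p (state h)) (configOf-sound p (state h) (state-sound f))

    -- Every prefix of a history that follows the strategy follows it as well.
    passes⇒¬clash : ∀ {p q} {h : History (G.arena φ) p} → HistoryFollows strategy h →
                    PassesThrough q h → ¬ G.Clash (G.pairs q)
    passes⇒¬clash f       now         = follows⇒¬clash f
    passes⇒¬clash (f ▷ _) (earlier v) = passes⇒¬clash f v

    strategy-wins : Winning (modelExistenceGame φ) strategy
    strategy-wins (finite h _) f (q , v , clash)          = passes⇒¬clash f v clash
    -- A clash shows up at a finite stage, so no limit argument is required.
    strategy-wins (infinite π) f (q , (n , refl) , clash) = follows⇒¬clash (f n) clash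

theorem2 : ∀ {ℓ} (L : Vocabulary) → Countable L → (M : Structure L ℓ) (φ : Formula L) → Sentence φ →
    Σ (EloiseStrategy (evaluationGame M φ) → EloiseStrategy (modelExistenceGame φ)) λ Φ →
    (τ : EloiseStrategy (evaluationGame M φ)) → Winning (evaluationGame M φ) τ → Winning (modelExistenceGame φ) (Φ τ)
theorem2 L _ M φ _ = (λ τ → Transfer.strategy M φ τ) , (λ τ → Transfer.strategy-wins M φ τ)
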